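{- For all integers $n\ge 1$ and $1\le k\le n$, $$\sum_{(\sigma,S)\in\mathfrak{S}^{>}_{n,n-k}} q^{\operatorname{maj}((\sigma,S))} = \sum_{i=1}^{k} q^{\binom{n-k}{2} - (n-k)(n-i)} {n-i \brack n-k}_q A_{n,n-i}(q).$$
   Context: $\mathfrak{S}_n$ is the set of permutations $\sigma=\sigma_1\cdots\sigma_n$ of $\{1,\dots,n\}$. For $\sigma\in\mathfrak{S}_n$: $\operatorname{Des}(\sigma)=\{i\in\{1,\dots,n-1\}:\sigma_i>\sigma_{i+1}\}$, $\operatorname{des}(\sigma)=|\operatorname{Des}(\sigma)|$, $\operatorname{maj}(\sigma)=\sum_{i\in\operatorname{Des}(\sigma)}i$. $\mathfrak{S}^{>}_{n,m}=\{(\sigma,S):\sigma\in\mathfrak{S}_n,\ S\subseteq\operatorname{Des}(\sigma),\ |S|=m\}$ (descent-starred permutations), and for $(\sigma,S)\in\mathfrak{S}^{>}_{n,m}$, $$\operatorname{maj}((\sigma,S))=\operatorname{maj}(\sigma)-\sum_{i\in S}|\operatorname{Des}(\sigma)\cap\{i,i+1,\dots,n-1\}|.$$ $A_{n,j}(q)=\sum_{\sigma\in\mathfrak{S}_n,\ \operatorname{des}(\sigma)=j}q^{\operatorname{maj}(\sigma)}$ is the coefficient of $t^j$ in $\sum_{\sigma\in\mathfrak{S}_n}q^{\operatorname{maj}(\sigma)}t^{\operatorname{des}(\sigma)}$. $[m]_q=1+q+\cdots+q^{m-1}$, $[m]_q!=[1]_q\cdots[m]_q$, and ${m\brack r}_q=\frac{[m]_q!}{[r]_q![m-r]_q!}$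 for $0\le r\le m$. -}

module Defs where

open import Data.Bool.Base using (true; false)
open import Data.Fin.Base using (Fin; suc; toℕ; inject₁)
import Data.Fin.Properties as Fin
open import Data.Fin.Subset using (Subset; _⊆_; _∩_; ∣_∣)
open import Data.Fin.Subset.Properties using (_∈?_; _⊆?_)
open import Data.Integer.Base using (ℤ; +_; 0ℤ; 1ℤ)
import Data.Integer.Base as ℤ
import Data.Integer.Properties as ℤ
open import Data.List.Base as List using (List; []; _∷_)
open import Data.Nat.Base using (ℕ; zero; suc; pred; _∸_)
import Data.Nat.Properties as ℕ
open import Data.Nat.ListAction using (sum)
open import Data.Product.Base using (_×_; _,_)
open import Data.Vec.Base as Vec using (Vec; []; _∷_)
open import Data.Vec.Relation.Unary.AllPairs using (allPairs?)
open import Data.Vec.Relation.Unary.Unique.Propositional using (Unique)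
open import Relation.Binary.PropositionalEquality using (_≡_)
open import Relation.Nullary.Decidable using (does; ¬?; _×-dec_)
open import Relation.Unary using (Decidable)

-- Permutations in one-line notation.  The letters and positions 1, …, n are
-- represented by Fin n (shifted by one); only the order of letters matters.

words : {A : Set} → List A → (n : ℕ) → List (Vec A n)
words as zero    = [] ∷ []
words as (suc n) = List.cartesianProductWith _∷_ as (words as n)

unique? : ∀ {m n} → Decidable (Unique {A = Fin m} {n})
unique? = allPairs? (λ x y → ¬? (x Fin.≟ y))

𝔖 : (n : ℕ) → List (Vec (Fin n) n)
𝔖 n = List.filter unique? (words (List.allFin n) n)

-- The set {1, …, n-1} is represented by Fin (pred n), with i standing for label i.

label : ∀ {m} → Fin m → ℕ
label i = suc (toℕ i)

elements : ∀ {m} → Subset m → List (Fin m)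
elements {m} S = List.filter (_∈? S) (List.allFin m)

subsets : (m : ℕ) → List (Subset m)
subsets m = words (true ∷ false ∷ []) m

Des : ∀ {n} → Vec (Fin n) n → Subset (pred n)
Des {zero}  σ = []
Des {suc n} σ = Vec.tabulate λ i →
  does (Vec.lookup σ (suc i) Fin.<? Vec.lookup σ (inject₁ i))

des : ∀ {n} → Vec (Fin n) n → ℕ
des σ = ∣ Des σ ∣

maj : ∀ {n} → Vec (Fin n) n → ℕ
maj σ = sum (List.map label (elements (Des σ)))

Starred : ℕ → Set
Starred n = Vec (Fin n) n × Subset (pred n)

IsStarred : ∀ {n} → ℕ → Starred n → Set
IsStarred m (σ , S) = S ⊆ Des σ × ∣ S ∣ ≡ m

isStarred? : ∀ {n} m → Decidable (IsStarred {n} m)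
isStarred? m (σ , S) = (S ⊆? Des σ) ×-dec (∣ S ∣ ℕ.≟ m)

𝔖> : (n m : ℕ) → List (Starred n)
𝔖> n m = List.filter (isStarred? m) (List.cartesianProduct (𝔖 n) (subsets (pred n)))

atLeast : ∀ {m} → Fin m → Subset m
atLeast i = Vec.tabulate λ j → does (i Fin.≤? j)

maj> : ∀ {n} → Starred n → ℤ
maj> (σ , S) =
  + maj σ ℤ.- + sum (List.map (λ i → ∣ Des σ ∩ atLeast i ∣) (elements S))

-- ℤ[q, q⁻¹]: a list of pairs (c , e) is the formal sum of the terms c q^e.

Laurent : Set
Laurent = List (ℤ × ℤ)

coeff : Laurent → ℤ → ℤ
coeff []            d = 0ℤ
coeff ((c , e) ∷ p) d with does (e ℤ.≟ d)
... | true  = c ℤ.+ coeff p d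
... | false = coeff p d

infix 4 _≈_
_≈_ : Laurent → Laurent → Set
p ≈ r = ∀ d → coeff p d ≡ coeff r d

q^_ : ℤ → Laurent
q^ e = (1ℤ , e) ∷ []

infixr 8 q^_

infixl 7 _·_
_·_ : Laurent → Laurent → Laurent
_·_ = List.cartesianProductWith λ (c , e) (c′ , e′) → c ℤ.* c′ , e ℤ.+ e′

∑ : {A : Set} → List A → (A → Laurent) → Laurent
∑ xs f = List.concatMap f xs

infix 5 ∑
syntax ∑ xs (λ x → p) = ∑[ x ← xs ] p

-- ℤ[q] as coefficient lists, constant term first.

Poly : Set
Poly = List ℤ

infixl 6 _⊕_
_⊕_ : Poly → Poly → Poly
[]      ⊕ g       = g
(a ∷ f) ⊕ []      = a ∷ f
(a ∷ f) ⊕ (b ∷ g) = a ℤ.+ b ∷ f ⊕ g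

scale : ℤ → Poly → Poly
scale a = List.map (a ℤ.*_)

infixl 7 _⊛_
_⊛_ : Poly → Poly → Poly
[]      ⊛ g = []
(a ∷ f) ⊛ g = scale a g ⊕ (0ℤ ∷ f ⊛ g)

-- Subtraction modulo q^n.
subtract : ∀ {n} → Vec ℤ n → Poly → Vec ℤ n
subtract []      g       = []
subtract (a ∷ f) []      = a ∷ f
subtract (a ∷ f) (b ∷ g) = a ℤ.- b ∷ subtract f g

-- divide f g is f / (1 + q g) modulo q^n, by ascending long division.
divide : ∀ {n} → Vec ℤ n → Poly → Vec ℤ n
divide []      g = []
divide (a ∷ f) g = a ∷ divide (subtract f (scale a g)) g

-- Quotient by a polynomial g with constant term 1 (not checked), computed in
-- ℤ[[q]] up to the length of f.  It is the exact quotient f / g whenever g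
-- divides f in ℤ[q], since the quotient's degree is then at most that of f.
infixl 7 _÷_
_÷_ : Poly → Poly → Poly
f ÷ []      = []
f ÷ (_ ∷ g) = Vec.toList (divide (Vec.fromList f) g)

[_]q : ℕ → Poly
[ m ]q = List.replicate m 1ℤ

[_]q! : ℕ → Poly
[ zero ]q!  = 1ℤ ∷ []
[ suc m ]q! = [ m ]q! ⊛ [ suc m ]q

-- Meaningful for r ≤ m only.
qBinomial : ℕ → ℕ → Poly
qBinomial m r = [ m ]q! ÷ ([ r ]q! ⊛ [ m ∸ r ]q!)

-- termsFrom e f is q^e f as a Laurent polynomial.
termsFrom : ℕ → Poly → Laurent
termsFrom e []      = []
termsFrom e (a ∷ f) = (a , + e) ∷ termsFrom (suc e) f

⟦_⟧ : Poly → Laurent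
⟦ f ⟧ = termsFrom 0 f

A : (n j : ℕ) → Laurent
A n j = ∑[ σ ← List.filter (λ σ → des σ ℕ.≟ j) (𝔖 n) ] q^ (+ maj σ)

-- The integers 1, …, k.
range : ℕ → List ℕ
range k = List.applyUpTo suc k

{-# OPTIONS --safe #-}
-- Fix σ with j descents.  A set S of m descents lowers maj by the sum of the ranks
-- of its elements, where descents are ranked 1, …, j from right to left; hence
-- ∑_S q^(-∑ ranks) runs over the m-subsets of {1, …, j} and equals
-- q^(C(m,2) - m j) [j, m].  Summing over σ by the value of j = n - i gives the claim;
-- permutations with fewer than m = n - k descents contribute nothing.
module Submission where

open import Defs
open import Algebra.Bundles using (CommutativeSemigroup)
import Algebra.Properties.CommutativeSemigroup as CommSemigroup
open import Data.Bool.Base using (Bool; true; false; if_then_else_; _∧_)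
open import Data.Bool.Properties using (∧-zeroʳ)
open import Data.Empty using (⊥-elim)
open import Data.Fin.Base using (Fin; zero; suc; toℕ)
open import Data.Fin.Subset using (Subset; ⊤; _∩_; ∣_∣)
open import Data.Fin.Subset.Properties using (_∈?_; _⊆?_; ∣p∣≤n; ∩-identityʳ)
open import Data.Integer.Base using (ℤ; +_; -[1+_]; _-_; 0ℤ; 1ℤ)
import Data.Integer.Base as ℤ
import Data.Integer.Properties as ℤ
open import Data.Integer.Tactic.RingSolver using (solve-∀)
open import Data.List.Base as List using (List; []; _∷_; _++_; length)
import Data.List.Properties as List
open import Data.List.Relation.Unary.All using (All; []; _∷_)
open import Data.List.Relation.Unary.All.Properties using (applyUpTo⁺₁)
open import Data.Nat.Base using (ℕ; zero; suc; pred; _≤_; _<_; _∸_; _*_; _⊔_; _≡ᵇ_; _≤ᵇ_; _<ᵇ_; z≤n; s≤s; z<s; s<s)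
import Data.Nat.Base as ℕ
open import Data.Nat.Combinatorics using (_C_; nC1≡n; nCk+nC[k+1]≡[n+1]C[k+1])
open import Data.Nat.ListAction using (sum)
import Data.Nat.Properties as ℕ
open import Data.Product.Base using (_,_)
open import Data.Vec.Base as Vec using (Vec; []; _∷_)
open import Data.Vec.Properties using (tabulate-cong; toList∘fromList; length-toList)
open import Function.Base using (_∘_; id)
open import Function.Bundles using (mk⇔)
open import Relation.Binary.PropositionalEquality
open import Relation.Nullary using (Dec; yes; no; does)
open import Relation.Nullary.Decidable using (dec-true; dec-false; does-⇔)
open import Relation.Unary using (Decidable)

-- Formal power series

-- Lists that differ by trailing zeros denote the same polynomial, so identities are proved between
-- coefficient functions, up to `_≗_`.
Series : Set
Series = ℕ → ℤ

infixl 6 _⊞_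
_⊞_ : Series → Series → Series
(f ⊞ g) n = f n ℤ.+ g n

infixl 7 _⋆_
-- The Cauchy product, read off from writing the first factor as f 0 + q f′; most laws follow by
-- peeling off that constant term.
_⋆_ : Series → Series → Series
(f ⋆ g) zero    = f 0 ℤ.* g 0
(f ⋆ g) (suc n) = f 0 ℤ.* g (suc n) ℤ.+ ((f ∘ suc) ⋆ g) n

one : Series
one zero    = 1ℤ
one (suc _) = 0ℤ

shift : ℕ → Series → Series
shift zero    f n       = f n
shift (suc k) f zero    = 0ℤ
shift (suc k) f (suc n) = shift k f n

⊞-cong : ∀ {f f′ g g′} → f ≗ f′ → g ≗ g′ → f ⊞ g ≗ f′ ⊞ g′
⊞-cong p r n = cong₂ ℤ._+_ (p n) (r n)

⋆-cong : ∀ {f f′ g g′} → f ≗ f′ → g ≗ g′ → f ⋆ g ≗ f′ ⋆ g′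
⋆-cong p r zero    = cong₂ ℤ._*_ (p 0) (r 0)
⋆-cong p r (suc n) =
  cong₂ ℤ._+_ (cong₂ ℤ._*_ (p 0) (r (suc n))) (⋆-cong (p ∘ suc) r n)

⋆-congˡ : ∀ f {g g′} → g ≗ g′ → f ⋆ g ≗ f ⋆ g′
⋆-congˡ f = ⋆-cong {f} λ _ → refl

⋆-congʳ : ∀ {f f′} g → f ≗ f′ → f ⋆ g ≗ f′ ⋆ g
⋆-congʳ g p = ⋆-cong {g = g} p λ _ → refl

-- Peels the constant term off the second factor instead of the first; with both recursions
-- available, commutativity is a plain induction.
⋆-sucʳ : ∀ f g n → (f ⋆ g) (suc n) ≡ f (suc n) ℤ.* g 0 ℤ.+ (f ⋆ (g ∘ suc)) n
⋆-sucʳ f g zero    = ℤ.+-comm (f 0 ℤ.* g 1) _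
⋆-sucʳ f g (suc n) =
  trans (cong (λ x → f 0 ℤ.* g (suc (suc n)) ℤ.+ x) (⋆-sucʳ (f ∘ suc) g n))
    (swap (f 0 ℤ.* g (suc (suc n))) (f (suc (suc n)) ℤ.* g 0) _)
  where
  swap : ∀ a b c → a ℤ.+ (b ℤ.+ c) ≡ b ℤ.+ (a ℤ.+ c)
  swap = solve-∀

⋆-comm : ∀ f g → f ⋆ g ≗ g ⋆ f
⋆-comm f g zero    = ℤ.*-comm (f 0) _
⋆-comm f g (suc n) = trans
  (cong₂ ℤ._+_ (ℤ.*-comm (f 0) _) (⋆-comm (f ∘ suc) g n))
  (sym (⋆-sucʳ g f n))

⋆-distribʳ-⊞ : ∀ h f g → (f ⊞ g) ⋆ h ≗ f ⋆ h ⊞ g ⋆ h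
⋆-distribʳ-⊞ h f g zero    = ℤ.*-distribʳ-+ (h 0) (f 0) _
⋆-distribʳ-⊞ h f g (suc n) = trans
  (cong (λ x → (f 0 ℤ.+ g 0) ℤ.* h (suc n) ℤ.+ x) (⋆-distribʳ-⊞ h (f ∘ suc) (g ∘ suc) n))
  (expand (f 0) (g 0) _ _ _)
  where
  expand : ∀ a b c d e → (a ℤ.+ b) ℤ.* c ℤ.+ (d ℤ.+ e) ≡ (a ℤ.* c ℤ.+ d) ℤ.+ (b ℤ.* c ℤ.+ e)
  expand = solve-∀

⋆-distribˡ-⊞ : ∀ h f g → h ⋆ (f ⊞ g) ≗ h ⋆ f ⊞ h ⋆ g
⋆-distribˡ-⊞ h f g n = trans (⋆-comm h (f ⊞ g) n)
  (trans (⋆-distribʳ-⊞ h f g n) (⊞-cong (⋆-comm f h) (⋆-comm g h) n))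

⋆-scaleˡ : ∀ a g h → (λ n → a ℤ.* g n) ⋆ h ≗ λ n → a ℤ.* (g ⋆ h) n
⋆-scaleˡ a g h zero    = ℤ.*-assoc a (g 0) _
⋆-scaleˡ a g h (suc n) = trans
  (cong₂ ℤ._+_ (ℤ.*-assoc a (g 0) _) (⋆-scaleˡ a (g ∘ suc) h n))
  (sym (ℤ.*-distribˡ-+ a _ _))

⋆-assoc : ∀ f g h → (f ⋆ g) ⋆ h ≗ f ⋆ (g ⋆ h)
⋆-assoc f g h zero    = ℤ.*-assoc (f 0) _ _
⋆-assoc f g h (suc n) = trans
  (cong (λ x → f 0 ℤ.* g 0 ℤ.* h (suc n) ℤ.+ x)
    (trans (⋆-distribʳ-⊞ h (λ k → f 0 ℤ.* g (suc k)) ((f ∘ suc) ⋆ g) n)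
      (cong₂ ℤ._+_ (⋆-scaleˡ (f 0) (g ∘ suc) h n) (⋆-assoc (f ∘ suc) g h n))))
  (factor (f 0) (g 0) _ _ _)
  where
  factor : ∀ a b c d e →
    a ℤ.* b ℤ.* c ℤ.+ (a ℤ.* d ℤ.+ e) ≡ a ℤ.* (b ℤ.* c ℤ.+ d) ℤ.+ e
  factor = solve-∀

⋆-zeroˡ : ∀ g → (λ _ → 0ℤ) ⋆ g ≗ λ _ → 0ℤ
⋆-zeroˡ g zero    = refl
⋆-zeroˡ g (suc n) = trans (ℤ.+-identityˡ _) (⋆-zeroˡ g n)

⋆-identityˡ : ∀ g → one ⋆ g ≗ g
⋆-identityˡ g zero    = ℤ.*-identityˡ _
⋆-identityˡ g (suc n) = trans
  (cong₂ ℤ._+_ (ℤ.*-identityˡ (g (suc n))) (⋆-zeroˡ g n)) (ℤ.+-identityʳ _)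

⋆-commutativeSemigroup : CommutativeSemigroup _ _
⋆-commutativeSemigroup = record
  { Carrier = Series
  ; _≈_ = _≗_
  ; _∙_ = _⋆_
  ; isCommutativeSemigroup = record
    { isSemigroup = record
      { isMagma = record
        { isEquivalence = record
          { refl = λ _ → refl
          ; sym = λ p n → sym (p n)
          ; trans = λ p r n → trans (p n) (r n)
          }
        ; ∙-cong = ⋆-cong
        }
      ; assoc = ⋆-assoc
      }
    ; comm = ⋆-comm
    }
  }

open CommSemigroup ⋆-commutativeSemigroup using (xy∙z≈xz∙y)

shift-cong : ∀ k {f g} → f ≗ g → shift k f ≗ shift k g
shift-cong zero    p n       = p n
shift-cong (suc k) p zero    = refl
shift-cong (suc k) p (suc n) = shift-cong k p n

shift-zeros : ∀ k → shift k (λ _ → 0ℤ) ≗ λ _ → 0ℤ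
shift-zeros zero    n       = refl
shift-zeros (suc k) zero    = refl
shift-zeros (suc k) (suc n) = shift-zeros k n

shift-⋆ : ∀ k f g → shift k f ⋆ g ≗ shift k (f ⋆ g)
shift-⋆ zero    f g n       = refl
shift-⋆ (suc k) f g zero    = refl
shift-⋆ (suc k) f g (suc n) = trans (ℤ.+-identityˡ _) (shift-⋆ k f g n)

⋆-shift : ∀ k f g → f ⋆ shift k g ≗ shift k (f ⋆ g)
⋆-shift k f g n = trans (⋆-comm f (shift k g) n)
  (trans (shift-⋆ k g f n) (shift-cong k (⋆-comm g f) n))

-- Coefficient lists and long division

at : Poly → Series
at []      _       = 0ℤ
at (a ∷ f) zero    = a
at (a ∷ f) (suc n) = at f n

at-⊕ : ∀ f g → at (f ⊕ g) ≗ at f ⊞ at g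
at-⊕ []      g       n       = sym (ℤ.+-identityˡ _)
at-⊕ (a ∷ f) []      n       = sym (ℤ.+-identityʳ _)
at-⊕ (a ∷ f) (b ∷ g) zero    = refl
at-⊕ (a ∷ f) (b ∷ g) (suc n) = at-⊕ f g n

at-scale : ∀ a f n → at (scale a f) n ≡ a ℤ.* at f n
at-scale a []      n       = sym (ℤ.*-zeroʳ a)
at-scale a (b ∷ f) zero    = refl
at-scale a (b ∷ f) (suc n) = at-scale a f n

at-⊛ : ∀ f g → at (f ⊛ g) ≗ at f ⋆ at g
at-⊛ []      g n       = sym (⋆-zeroˡ (at g) n)
at-⊛ (a ∷ f) g zero    = trans (at-⊕ (scale a g) (0ℤ ∷ f ⊛ g) 0)
  (trans (ℤ.+-identityʳ _) (at-scale a g 0))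
at-⊛ (a ∷ f) g (suc n) = trans (at-⊕ (scale a g) (0ℤ ∷ f ⊛ g) (suc n))
  (cong₂ ℤ._+_ (at-scale a g (suc n)) (at-⊛ f g n))

at-≥-length : ∀ f {d} → length f ≤ d → at f d ≡ 0ℤ
at-≥-length []      _       = refl
at-≥-length (a ∷ f) (s≤s p) = at-≥-length f p

-- Restricted to d < n because `subtract` discards the entries of g beyond the vector, where the
-- right-hand side may be nonzero.
at-subtract : ∀ {n} (v : Vec ℤ n) g {d} → d < n →
  at (Vec.toList (subtract v g)) d ≡ at (Vec.toList v) d - at g d
at-subtract (a ∷ f) []      p                 = sym (ℤ.+-identityʳ _)
at-subtract (a ∷ f) (b ∷ g) {d = zero}  p     = refl
at-subtract (a ∷ f) (b ∷ g) {d = suc d} (s≤s p) = at-subtract f g p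

-- Dropping the lowest coefficient h 0 from a quotient h changes the dividend v to
-- (v - h 0 (1 + q g)) / q, which is the recursive call of divide.
divide-correct : ∀ {n} (v : Vec ℤ n) g h →
  (∀ {d} → d < n → at (Vec.toList v) d ≡ (at (1ℤ ∷ g) ⋆ h) d) →
  ∀ {d} → d < n → at (Vec.toList (divide v g)) d ≡ h d
divide-correct (a ∷ v) g h eq {zero}  p       = trans (eq p) (ℤ.*-identityˡ _)
divide-correct (a ∷ v) g h eq {suc d} (s≤s p) =
  divide-correct (subtract v (scale a g)) g (h ∘ suc) eq′ p
  where
  cancel : ∀ x y z → 1ℤ ℤ.* x ℤ.+ (y ℤ.+ z) - y ≡ 1ℤ ℤ.* x ℤ.+ z
  cancel = solve-∀

  a≡h0 : a ≡ h 0
  a≡h0 = trans (eq z<s) (ℤ.*-identityˡ _)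

  open ≡-Reasoning
  eq′ : ∀ {d} → d < _ →
    at (Vec.toList (subtract v (scale a g))) d ≡ (at (1ℤ ∷ g) ⋆ (h ∘ suc)) d
  eq′ {zero} p = begin
    at (Vec.toList (subtract v (scale a g))) 0 ≡⟨ at-subtract v (scale a g) p ⟩
    at (Vec.toList v) 0 - at (scale a g) 0
      ≡⟨ cong₂ _-_ (eq (s<s p)) (at-scale a g 0) ⟩
    1ℤ ℤ.* h 1 ℤ.+ at g 0 ℤ.* h 0 - a ℤ.* at g 0
      ≡⟨ cong (λ x → 1ℤ ℤ.* h 1 ℤ.+ at g 0 ℤ.* h 0 - x ℤ.* at g 0) a≡h0 ⟩
    1ℤ ℤ.* h 1 ℤ.+ at g 0 ℤ.* h 0 - h 0 ℤ.* at g 0 ≡⟨ cancel₀ (h 1) (at g 0) (h 0) ⟩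
    1ℤ ℤ.* h 1 ∎
    where
    cancel₀ : ∀ x y z → 1ℤ ℤ.* x ℤ.+ y ℤ.* z - z ℤ.* y ≡ 1ℤ ℤ.* x
    cancel₀ = solve-∀
  eq′ {suc d} p = begin
    at (Vec.toList (subtract v (scale a g))) (suc d) ≡⟨ at-subtract v (scale a g) p ⟩
    at (Vec.toList v) (suc d) - at (scale a g) (suc d)
      ≡⟨ cong₂ _-_ (eq (s<s p)) (at-scale a g (suc d)) ⟩
    1ℤ ℤ.* h (suc (suc d)) ℤ.+ (at g ⋆ h) (suc d) - a ℤ.* at g (suc d)
      -- Peeling h rather than g exposes the product of `at g (suc d)` and `h 0`, which is what the
      -- division step subtracts.
      ≡⟨ cong₂ (λ x y → 1ℤ ℤ.* h (suc (suc d)) ℤ.+ x - y)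
           (⋆-sucʳ (at g) h d)
           (trans (cong (ℤ._* at g (suc d)) a≡h0) (ℤ.*-comm (h 0) _)) ⟩
    1ℤ ℤ.* h (suc (suc d)) ℤ.+ (at g (suc d) ℤ.* h 0 ℤ.+ (at g ⋆ (h ∘ suc)) d)
      - at g (suc d) ℤ.* h 0
      ≡⟨ cancel (h (suc (suc d))) _ _ ⟩
    1ℤ ℤ.* h (suc (suc d)) ℤ.+ (at g ⋆ (h ∘ suc)) d ∎

-- Below `length f` the long division recovers h; from there on the computed list has ended, and the
-- degree hypothesis makes h vanish too.
÷-exact : ∀ f g h → at g 0 ≡ 1ℤ → at f ≗ at g ⋆ h →
  (∀ {d} → length f ≤ d → h d ≡ 0ℤ) → at (f ÷ g) ≗ h
÷-exact f []      h ()   eq deg d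
÷-exact f (_ ∷ g) h refl eq deg d with d ℕ.<? length f
... | yes d<l = divide-correct (Vec.fromList f) g h
  (λ {e} _ → trans (cong (λ l → at l e) (toList∘fromList f)) (eq e)) d<l
... | no d≮l = trans
  (at-≥-length (Vec.toList (divide (Vec.fromList f) g))
    (ℕ.≤-trans (ℕ.≤-reflexive (length-toList (divide (Vec.fromList f) g))) (ℕ.≮⇒≥ d≮l)))
  (sym (deg (ℕ.≮⇒≥ d≮l)))

-- Gaussian binomials

-- The Gaussian binomial, defined by the q-Pascal rule and equal to zero for m > j.
gauss : ℕ → ℕ → Series
gauss j       zero    = one
gauss zero    (suc m) = λ _ → 0ℤ
gauss (suc j) (suc m) = gauss j m ⊞ shift (suc m) (gauss j (suc m))

gauss-< : ∀ {j m} → j < m → gauss j m ≗ λ _ → 0ℤ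
gauss-< {zero}  {suc m} p       n = refl
gauss-< {suc j} {suc m} (s≤s p) n = cong₂ ℤ._+_ (gauss-< p n)
  (trans (shift-cong (suc m) (gauss-< (ℕ.m<n⇒m<1+n p)) n) (shift-zeros (suc m) n))

gauss-diagonal : ∀ m → gauss m m ≗ one
gauss-diagonal zero    n = refl
gauss-diagonal (suc m) n = trans
  (cong₂ ℤ._+_ (gauss-diagonal m n)
    (trans (shift-cong (suc m) (gauss-< (ℕ.n<1+n m)) n) (shift-zeros (suc m) n)))
  (ℤ.+-identityʳ _)

qint : ℕ → Series
qint m = at [ m ]q

qfact : ℕ → Series
qfact m = at [ m ]q!

qint-+ : ∀ a b → qint a ⊞ shift a (qint b) ≗ qint (a ℕ.+ b)
qint-+ zero    b n       = ℤ.+-identityˡ _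
qint-+ (suc a) b zero    = refl
qint-+ (suc a) b (suc n) = qint-+ a b n

qfact-suc : ∀ m → qfact (suc m) ≗ qfact m ⋆ qint (suc m)
qfact-suc m = at-⊛ [ m ]q! [ suc m ]q

qfact-0 : ∀ m → qfact m 0 ≡ 1ℤ
qfact-0 zero    = refl
qfact-0 (suc m) = trans (qfact-suc m 0) (cong (ℤ._* 1ℤ) (qfact-0 m))

qfact-zero : qfact 0 ≗ one
qfact-zero zero    = refl
qfact-zero (suc n) = refl

-- The factorial formula cleared of denominators, by induction along q-Pascal. With N =
-- [a + b + 1]!, the two summands become N [a + 1] and q^(a + 1) N [b + 1], which `qint-+` merges
-- into N [a + b + 2].
gauss-qfact : ∀ a b → gauss (a ℕ.+ b) a ⋆ (qfact a ⋆ qfact b) ≗ qfact (a ℕ.+ b)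
gauss-qfact zero b n = trans (⋆-identityˡ (qfact 0 ⋆ qfact b) n)
  (trans (⋆-congʳ (qfact b) qfact-zero n) (⋆-identityˡ (qfact b) n))
gauss-qfact (suc a) zero n rewrite ℕ.+-identityʳ a =
  trans (⋆-cong (gauss-diagonal (suc a))
          (λ k → trans (⋆-comm (qfact (suc a)) (qfact 0) k)
            (trans (⋆-congʳ (qfact (suc a)) qfact-zero k) (⋆-identityˡ (qfact (suc a)) k))) n)
    (⋆-identityˡ (qfact (suc a)) n)
gauss-qfact (suc a) (suc b) n = begin
  ((X ⊞ shift (suc a) Y) ⋆ (qfact (suc a) ⋆ qfact (suc b))) n
    ≡⟨ ⋆-distribʳ-⊞ _ X (shift (suc a) Y) n ⟩
  (X ⋆ (qfact (suc a) ⋆ qfact (suc b))) n ℤ.+ (shift (suc a) Y ⋆ (qfact (suc a) ⋆ qfact (suc b))) n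
    ≡⟨ cong₂ ℤ._+_ (left n)
         (trans (shift-⋆ (suc a) Y _ n)
           (trans (shift-cong (suc a) right n) (sym (⋆-shift (suc a) N (qint (suc b)) n)))) ⟩
  (N ⋆ qint (suc a)) n ℤ.+ (N ⋆ shift (suc a) (qint (suc b))) n
    ≡⟨ ⋆-distribˡ-⊞ N (qint (suc a)) _ n ⟨
  (N ⋆ (qint (suc a) ⊞ shift (suc a) (qint (suc b)))) n
    ≡⟨ ⋆-congˡ N (qint-+ (suc a) (suc b)) n ⟩
  (N ⋆ qint (suc a ℕ.+ suc b)) n
    ≡⟨ qfact-suc (a ℕ.+ suc b) n ⟨
  qfact (suc a ℕ.+ suc b) n ∎
  where
  open ≡-Reasoning
  X Y N : Series
  X = gauss (a ℕ.+ suc b) a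
  Y = gauss (a ℕ.+ suc b) (suc a)
  N = qfact (a ℕ.+ suc b)

  left : X ⋆ (qfact (suc a) ⋆ qfact (suc b)) ≗ N ⋆ qint (suc a)
  left k = begin
    (X ⋆ (qfact (suc a) ⋆ qfact (suc b))) k
      ≡⟨ ⋆-congˡ X (⋆-congʳ (qfact (suc b)) (qfact-suc a)) k ⟩
    (X ⋆ ((qfact a ⋆ qint (suc a)) ⋆ qfact (suc b))) k
      ≡⟨ ⋆-congˡ X (xy∙z≈xz∙y (qfact a) (qint (suc a)) (qfact (suc b))) k ⟩
    (X ⋆ ((qfact a ⋆ qfact (suc b)) ⋆ qint (suc a))) k
      ≡⟨ ⋆-assoc X (qfact a ⋆ qfact (suc b)) (qint (suc a)) k ⟨
    (X ⋆ (qfact a ⋆ qfact (suc b)) ⋆ qint (suc a)) k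
      ≡⟨ ⋆-congʳ (qint (suc a)) (gauss-qfact a (suc b)) k ⟩
    (N ⋆ qint (suc a)) k ∎

  IH : Y ⋆ (qfact (suc a) ⋆ qfact b) ≗ N
  IH k = subst (λ s → (gauss s (suc a) ⋆ (qfact (suc a) ⋆ qfact b)) k ≡ qfact s k)
    (sym (ℕ.+-suc a b)) (gauss-qfact (suc a) b k)

  right : Y ⋆ (qfact (suc a) ⋆ qfact (suc b)) ≗ N ⋆ qint (suc b)
  right k = begin
    (Y ⋆ (qfact (suc a) ⋆ qfact (suc b))) k
      ≡⟨ ⋆-congˡ Y (⋆-congˡ (qfact (suc a)) (qfact-suc b)) k ⟩
    (Y ⋆ (qfact (suc a) ⋆ (qfact b ⋆ qint (suc b)))) k
      ≡⟨ ⋆-congˡ Y (⋆-assoc (qfact (suc a)) (qfact b) (qint (suc b))) k ⟨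
    (Y ⋆ ((qfact (suc a) ⋆ qfact b) ⋆ qint (suc b))) k
      ≡⟨ ⋆-assoc Y (qfact (suc a) ⋆ qfact b) (qint (suc b)) k ⟨
    (Y ⋆ (qfact (suc a) ⋆ qfact b) ⋆ qint (suc b)) k
      ≡⟨ ⋆-congʳ (qint (suc b)) IH k ⟩
    (N ⋆ qint (suc b)) k ∎

-- Length bounds and exactness of the q-binomial quotient

length-⊕ : ∀ f g → length (f ⊕ g) ≡ length f ⊔ length g
length-⊕ []      g       = refl
length-⊕ (a ∷ f) []      = refl
length-⊕ (a ∷ f) (b ∷ g) = cong suc (length-⊕ f g)

-- List length stands in for degree: `_⊕_` keeps the longer length even when coefficients cancel, so
-- a product never comes out too short.
length-⊛ : ∀ a f g → length f ℕ.+ length g ≤ length ((a ∷ f) ⊛ g)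
length-⊛ a f g = ℕ.≤-trans (bound f) (ℕ.≤-reflexive (sym eq))
  where
  eq : length ((a ∷ f) ⊛ g) ≡ length g ⊔ suc (length (f ⊛ g))
  eq = trans (length-⊕ (scale a g) _) (cong (_⊔ suc (length (f ⊛ g))) (List.length-map (a ℤ.*_) g))

  bound : ∀ f → length f ℕ.+ length g ≤ length g ⊔ suc (length (f ⊛ g))
  bound []      = ℕ.m≤m⊔n (length g) _
  bound (b ∷ f) = ℕ.≤-trans (s≤s (length-⊛ b f g)) (ℕ.m≤n⊔m (length g) _)

length-qfact-pos : ∀ m → 1 ≤ length [ m ]q!
length-qfact-pos m with [ m ]q! | qfact-0 m
... | []    | ()
... | _ ∷ _ | _ = s≤s z≤n

length-qfact-suc : ∀ m → length [ m ]q! ℕ.+ m ≤ length [ suc m ]q!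
length-qfact-suc m with [ m ]q! | length-qfact-pos m
... | a ∷ f | _ = subst (_≤ length ((a ∷ f) ⊛ [ suc m ]q))
  (trans (cong (length f ℕ.+_) (List.length-replicate (suc m))) (ℕ.+-suc (length f) m))
  (length-⊛ a f [ suc m ]q)

shift-vanish : ∀ k {l f} → (∀ {d} → l ≤ d → f d ≡ 0ℤ) → ∀ {d} → l ℕ.+ k ≤ d → shift k f d ≡ 0ℤ
shift-vanish zero    {l} v p = v (subst (_≤ _) (ℕ.+-identityʳ l) p)
shift-vanish (suc k) {l} v {zero}  p = refl
shift-vanish (suc k) {l} v {suc d} p =
  shift-vanish k v (ℕ.s≤s⁻¹ (subst (_≤ suc d) (ℕ.+-suc l k) p))

-- A crude degree bound, just enough for the truncation of _÷_ at the length of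
-- its dividend [ j ]q! to lose nothing.
gauss-degree : ∀ j m {d} → length [ j ]q! ≤ d → gauss j m d ≡ 0ℤ
gauss-degree j       zero {zero}  p = ⊥-elim (ℕ.<⇒≱ (length-qfact-pos j) p)
gauss-degree j       zero {suc d} p = refl
gauss-degree zero    (suc m)      p = refl
gauss-degree (suc j) (suc m) {d}  p = cong₂ ℤ._+_ (gauss-degree j m (ℕ.m+n≤o⇒m≤o _ p′)) right
  where
  p′ : length [ j ]q! ℕ.+ j ≤ d
  p′ = ℕ.≤-trans (length-qfact-suc j) p

  right : shift (suc m) (gauss j (suc m)) d ≡ 0ℤ
  -- For m < j, the at least j extra entries of `[ suc j ]q!` absorb a shift by m + 1; otherwise the
  -- shifted binomial is zero.
  right with suc m ℕ.≤? j
  ... | yes m<j = shift-vanish (suc m) (gauss-degree j (suc m))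
                    (ℕ.≤-trans (ℕ.+-monoʳ-≤ (length [ j ]q!) m<j) p′)
  ... | no m≮j = trans (shift-cong (suc m) (gauss-< (ℕ.≰⇒> m≮j)) d) (shift-zeros (suc m) d)

-- The factorial formula at j = m + (j - m) makes the division exact; the denominator has constant
-- term 1, and `gauss-degree` covers the truncation.
qBinomial-gauss : ∀ {j m} → m ≤ j → at (qBinomial j m) ≗ gauss j m
qBinomial-gauss {j} {m} m≤j =
  ÷-exact [ j ]q! ([ m ]q! ⊛ [ j ∸ m ]q!) (gauss j m) const eq (gauss-degree j m)
  where
  den : at ([ m ]q! ⊛ [ j ∸ m ]q!) ≗ qfact m ⋆ qfact (j ∸ m)
  den = at-⊛ [ m ]q! [ j ∸ m ]q!

  const : at ([ m ]q! ⊛ [ j ∸ m ]q!) 0 ≡ 1ℤ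
  const = trans (den 0) (cong₂ ℤ._*_ (qfact-0 m) (qfact-0 (j ∸ m)))

  eq : qfact j ≗ at ([ m ]q! ⊛ [ j ∸ m ]q!) ⋆ gauss j m
  eq n = trans
    (subst (λ s → qfact s n ≡ (gauss s m ⋆ (qfact m ⋆ qfact (j ∸ m))) n) (ℕ.m+[n∸m]≡n m≤j)
      (sym (gauss-qfact m (j ∸ m) n)))
    (trans (⋆-comm (gauss j m) _ n) (⋆-congʳ (gauss j m) (λ k → sym (den k)) n))

-- Finite sums

-- An Iverson bracket: filter conditions become factors inside sums over fixed lists, which can then
-- be interchanged.
guard : Bool → ℤ → ℤ
guard b v = if b then v else 0ℤ

-- The equality is needed only where the condition holds, so `des σ ≡ j` may be assumed under its
-- bracket.
guard-cong : ∀ {P : Set} (P? : Dec P) {v w} → (P → v ≡ w) →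
  guard (does P?) v ≡ guard (does P?) w
guard-cong (yes p) eq = eq p
guard-cong (no _)  eq = refl

*-guard : ∀ a b v → guard b (a ℤ.* v) ≡ a ℤ.* guard b v
*-guard a true  v = refl
*-guard a false v = sym (ℤ.*-zeroʳ a)

total : {X : Set} → List X → (X → ℤ) → ℤ
total []       F = 0ℤ
total (x ∷ xs) F = F x ℤ.+ total xs F

module _ {X : Set} where

  total-cong-All : ∀ {F G : X → ℤ} {xs} → All (λ x → F x ≡ G x) xs → total xs F ≡ total xs G
  total-cong-All []       = refl
  total-cong-All (p ∷ ps) = cong₂ ℤ._+_ p (total-cong-All ps)

  total-cong : ∀ (xs : List X) {F G} → F ≗ G → total xs F ≡ total xs G
  total-cong []       eq = refl
  total-cong (x ∷ xs) eq = cong₂ ℤ._+_ (eq x) (total-cong xs eq)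

  total-zero : ∀ (xs : List X) → total xs (λ _ → 0ℤ) ≡ 0ℤ
  total-zero []       = refl
  total-zero (x ∷ xs) = trans (ℤ.+-identityˡ _) (total-zero xs)

  total-+ : ∀ (xs : List X) F G → total xs (λ x → F x ℤ.+ G x) ≡ total xs F ℤ.+ total xs G
  total-+ []       F G = refl
  total-+ (x ∷ xs) F G = trans
    (cong (λ t → F x ℤ.+ G x ℤ.+ t) (total-+ xs F G))
    (interchange (F x) (G x) _ _)
    where
    interchange : ∀ a b c e → a ℤ.+ b ℤ.+ (c ℤ.+ e) ≡ a ℤ.+ c ℤ.+ (b ℤ.+ e)
    interchange = solve-∀

  total-*ˡ : ∀ a (xs : List X) F → total xs (λ x → a ℤ.* F x) ≡ a ℤ.* total xs F
  total-*ˡ a []       F = sym (ℤ.*-zeroʳ a)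
  total-*ˡ a (x ∷ xs) F = trans
    (cong (λ t → a ℤ.* F x ℤ.+ t) (total-*ˡ a xs F)) (sym (ℤ.*-distribˡ-+ a (F x) _))

  total-++ : ∀ (xs ys : List X) F → total (xs ++ ys) F ≡ total xs F ℤ.+ total ys F
  total-++ []       ys F = sym (ℤ.+-identityˡ _)
  total-++ (x ∷ xs) ys F = trans
    (cong (λ t → F x ℤ.+ t) (total-++ xs ys F)) (sym (ℤ.+-assoc (F x) _ _))

  total-filter : ∀ {P : X → Set} (P? : Decidable P) xs F →
    total (List.filter P? xs) F ≡ total xs (λ x → guard (does (P? x)) (F x))
  total-filter P? []       F = refl
  total-filter P? (x ∷ xs) F with does (P? x)
  ... | true  = cong (λ t → F x ℤ.+ t) (total-filter P? xs F)
  ... | false = trans (total-filter P? xs F) (sym (ℤ.+-identityˡ _))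

module _ {X Y : Set} where

  total-map : ∀ (h : X → Y) xs F → total (List.map h xs) F ≡ total xs (F ∘ h)
  total-map h []       F = refl
  total-map h (x ∷ xs) F = cong (λ t → F (h x) ℤ.+ t) (total-map h xs F)

  total-∑ : ∀ (xs : List X) (h : X → List Y) F →
    total (List.concatMap h xs) F ≡ total xs (λ x → total (h x) F)
  total-∑ []       h F = refl
  total-∑ (x ∷ xs) h F = trans
    (total-++ (h x) (List.concatMap h xs) F) (cong (λ t → total (h x) F ℤ.+ t) (total-∑ xs h F))

  total-swap : ∀ (xs : List X) (ys : List Y) (F : X → Y → ℤ) →
    total xs (λ x → total ys (F x)) ≡ total ys (λ y → total xs (λ x → F x y))
  total-swap []       ys F = sym (total-zero ys)
  total-swap (x ∷ xs) ys F = trans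
    (cong (λ t → total ys (F x) ℤ.+ t) (total-swap xs ys F)) (sym (total-+ ys (F x) _))

total-cartesianProductWith : ∀ {X Y Z : Set} (h : X → Y → Z) xs ys F →
  total (List.cartesianProductWith h xs ys) F ≡ total xs (λ x → total ys (λ y → F (h x y)))
total-cartesianProductWith h []       ys F = refl
total-cartesianProductWith h (x ∷ xs) ys F = trans
  (total-++ (List.map (h x) ys) _ F)
  (cong₂ ℤ._+_ (total-map (h x) ys F) (total-cartesianProductWith h xs ys F))

total-applyUpTo : ∀ {X : Set} (h : ℕ → X) g k F →
  total (List.applyUpTo (h ∘ g) k) F ≡ total (List.applyUpTo g k) (F ∘ h)
total-applyUpTo h g zero    F = refl
total-applyUpTo h g (suc k) F = cong (λ t → F (h (g 0)) ℤ.+ t) (total-applyUpTo h (g ∘ suc) k F)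

total-range-suc : ∀ k F → total (range (suc k)) F ≡ F 1 ℤ.+ total (range k) (F ∘ suc)
total-range-suc k F = cong (λ t → F 1 ℤ.+ t) (total-applyUpTo suc suc k F)

-- For i = 1, ..., k the values n - i all lie below n, so j ≥ n is never met.
range-miss : ∀ {n k j} v → k ≤ n → n ≤ j →
  total (range k) (λ i → guard (does (j ℕ.≟ n ∸ i)) v) ≡ 0ℤ
range-miss {n} {zero} v k≤n n≤j = refl
range-miss {suc n} {suc k} {j} v (s≤s k≤n) n<j = trans
  (total-range-suc k (λ i → guard (does (j ℕ.≟ suc n ∸ i)) v))
  (cong₂ (λ b t → guard b v ℤ.+ t) (dec-false (j ℕ.≟ n) (ℕ.>⇒≢ n<j))
    (range-miss v k≤n (ℕ.<⇒≤ n<j)))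

-- The values n - 1, ..., n - k are distinct, so j is met once if j ≥ n - k; a smaller j is never
-- met, and v is then zero.
range-hit : ∀ {n k j} v → k ≤ n → j < n → (j < n ∸ k → v ≡ 0ℤ) →
  total (range k) (λ i → guard (does (j ℕ.≟ n ∸ i)) v) ≡ v
range-hit {n} {zero} v k≤n j<n v≡0 = sym (v≡0 j<n)
range-hit {suc n} {suc k} {j} v (s≤s k≤n) j<1+n v≡0 = trans
  (total-range-suc k (λ i → guard (does (j ℕ.≟ suc n ∸ i)) v)) head
  where
  head : guard (does (j ℕ.≟ n)) v ℤ.+ total (range k) (λ i → guard (does (j ℕ.≟ n ∸ i)) v) ≡ v
  head with j ℕ.≟ n
  ... | yes refl = trans
    (cong₂ (λ b t → guard b v ℤ.+ t) (dec-true (n ℕ.≟ n) refl) (range-miss v k≤n ℕ.≤-refl))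
    (ℤ.+-identityʳ v)
  ... | no j≢n   = trans
    (cong₂ (λ b t → guard b v ℤ.+ t) (dec-false (j ℕ.≟ n) j≢n)
      (range-hit v k≤n (ℕ.≤∧≢⇒< (ℕ.s≤s⁻¹ j<1+n) j≢n) v≡0))
    (ℤ.+-identityˡ v)

-- Coefficients of Laurent polynomials

-- Turns the branching recursion of `coeff` into a sum, so that the laws of `total` apply to
-- coefficients.
coeff-total : ∀ p d → coeff p d ≡ total p (λ (c , e) → guard (does (e ℤ.≟ d)) c)
coeff-total []            d = refl
coeff-total ((c , e) ∷ p) d with does (e ℤ.≟ d)
... | true  = cong (λ t → c ℤ.+ t) (coeff-total p d)
... | false = trans (coeff-total p d) (sym (ℤ.+-identityˡ _))

coeff-∑ : ∀ {X : Set} (xs : List X) f d → coeff (∑ xs f) d ≡ total xs (λ x → coeff (f x) d)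
coeff-∑ xs f d = trans (coeff-total (∑ xs f) d)
  (trans (total-∑ xs f _) (total-cong xs λ x → sym (coeff-total (f x) d)))

coeff-monomial : ∀ e d → coeff (q^ e) d ≡ guard (does (e ℤ.≟ d)) 1ℤ
coeff-monomial e d = trans (coeff-total (q^ e) d) (ℤ.+-identityʳ _)

+-≟-move : ∀ x y z → does (x ℤ.+ y ℤ.≟ z) ≡ does (y ℤ.≟ z - x)
+-≟-move x y z = does-⇔
  (mk⇔ (λ { refl → move x y }) (λ { refl → back x z }))
  (x ℤ.+ y ℤ.≟ z) (y ℤ.≟ z - x)
  where
  move : ∀ x y → y ≡ x ℤ.+ y - x
  move = solve-∀
  back : ∀ x z → x ℤ.+ (z - x) ≡ z
  back = solve-∀

coeff-·ˡ : ∀ p r d → coeff (p · r) d ≡ total p (λ (c , e) → c ℤ.* coeff r (d - e))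
coeff-·ˡ p r d = trans (coeff-total (p · r) d)
  (trans (total-cartesianProductWith _ p r _)
    (total-cong p λ (c , e) → trans
      (total-cong r λ (c′ , e′) → trans
        (cong (λ b → guard b (c ℤ.* c′)) (+-≟-move e e′ d)) (*-guard c _ c′))
      (trans (total-*ˡ c r _) (cong (c ℤ.*_) (sym (coeff-total r (d - e)))))))

-- Expansion along the right factor serves products ending in a sum of monomials, such as `A n j`;
-- expansion along the left serves a leading monomial.
coeff-·ʳ : ∀ p r d → coeff (p · r) d ≡ total r (λ (c , e) → c ℤ.* coeff p (d - e))
coeff-·ʳ p r d = trans (coeff-total (p · r) d)
  (trans (total-cartesianProductWith _ p r _)
    (trans (total-swap p r _)
      (total-cong r λ (c , e) → trans
        (total-cong p λ (c′ , e′) → trans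
          (cong₂ guard
            (trans (cong (λ s → does (s ℤ.≟ d)) (ℤ.+-comm e′ e)) (+-≟-move e e′ d))
            (ℤ.*-comm c′ c))
          (*-guard c _ c′))
        (trans (total-*ˡ c p _) (cong (c ℤ.*_) (sym (coeff-total p (d - e))))))))

coeff-q^· : ∀ a p d → coeff (q^ a · p) d ≡ coeff p (d - a)
coeff-q^· a p d = trans (coeff-·ˡ (q^ a) p d)
  (trans (ℤ.+-identityʳ _) (ℤ.*-identityˡ _))

coeff-·∑q^ : ∀ {X : Set} p (xs : List X) (e : X → ℤ) d →
  coeff (p · ∑ xs (λ x → q^ (e x))) d ≡ total xs (λ x → coeff p (d - e x))
coeff-·∑q^ p xs e d = trans (coeff-·ʳ p _ d)
  (trans (total-∑ xs _ _)
    (total-cong xs λ x → trans (ℤ.+-identityʳ _) (ℤ.*-identityˡ _)))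

-- Coefficients at all integer exponents, so that arguments can be translated by negative amounts as
-- well.
extend : Series → ℤ → ℤ
extend f (+ n)    = f n
extend f -[1+ n ] = 0ℤ

extend-cong : ∀ {f g} → f ≗ g → extend f ≗ extend g
extend-cong p (+ n)    = p n
extend-cong p -[1+ n ] = refl

extend-zero : extend (λ _ → 0ℤ) ≗ λ _ → 0ℤ
extend-zero (+ n)    = refl
extend-zero -[1+ n ] = refl

extend-⊞ : ∀ f g x → extend (f ⊞ g) x ≡ extend f x ℤ.+ extend g x
extend-⊞ f g (+ n)    = refl
extend-⊞ f g -[1+ n ] = refl

extend-shift : ∀ k f x → extend (shift k f) x ≡ extend f (x - + k)
extend-shift zero    f (+ n)       = cong f (sym (ℕ.+-identityʳ n))
extend-shift zero    f -[1+ n ]    = refl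
extend-shift (suc k) f (+ zero)    = refl
extend-shift (suc k) f (+ (suc n)) = trans (extend-shift k f (+ n))
  (cong (extend f) (trans (ℤ.m-n≡m⊖n n k) (sym (ℤ.[1+m]⊖[1+n]≡m⊖n n k))))
extend-shift (suc k) f -[1+ n ]    = refl

shift-∷ : ∀ k a f n → shift k (at (a ∷ f)) n ≡ guard (k ≡ᵇ n) a ℤ.+ shift (suc k) (at f) n
shift-∷ zero    a f zero    = sym (ℤ.+-identityʳ a)
shift-∷ zero    a f (suc n) = sym (ℤ.+-identityˡ _)
shift-∷ (suc k) a f zero    = refl
shift-∷ (suc k) a f (suc n) = shift-∷ k a f n

coeff-termsFrom : ∀ k f d → coeff (termsFrom k f) d ≡ extend (shift k (at f)) d
coeff-termsFrom k []      d         = sym (trans (extend-cong (shift-zeros k) d) (extend-zero d))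
coeff-termsFrom k (a ∷ f) (+ n)     = trans
  (coeff-∷ (termsFrom (suc k) f))
  (trans (cong (λ t → guard (k ≡ᵇ n) a ℤ.+ t) (coeff-termsFrom (suc k) f (+ n)))
    (sym (shift-∷ k a f n)))
  where
  coeff-∷ : ∀ p → coeff ((a , + k) ∷ p) (+ n) ≡ guard (k ≡ᵇ n) a ℤ.+ coeff p (+ n)
  coeff-∷ p with k ≡ᵇ n
  ... | true  = refl
  ... | false = sym (ℤ.+-identityˡ _)
coeff-termsFrom k (a ∷ f) -[1+ n ] = coeff-termsFrom (suc k) f -[1+ n ]

-- Starred subsets

elements-∷ : ∀ {m} s (S : Subset m) →
  elements (s ∷ S) ≡ (if s then zero ∷_ else id) (List.map suc (elements S))
elements-∷ {m} s S = cases s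
  where
  tail : ∀ s → List.filter (_∈? (s ∷ S)) (List.tabulate suc) ≡ List.map suc (elements S)
  tail s = trans (cong (List.filter (_∈? (s ∷ S))) (sym (List.map-tabulate id suc)))
    (go (List.allFin m))
    where
    go : ∀ xs → List.filter (_∈? (s ∷ S)) (List.map suc xs) ≡ List.map suc (List.filter (_∈? S) xs)
    go []       = refl
    go (x ∷ xs) with does (x ∈? S)
    ... | true  = cong (suc x ∷_) (go xs)
    ... | false = go xs

  cases : ∀ s → elements (s ∷ S) ≡ (if s then zero ∷_ else id) (List.map suc (elements S))
  cases true  = cong (zero ∷_) (tail true)
  cases false = tail false

-- The amount that starring S subtracts from maj when D is the descent set; for i in D the summand
-- is the rank of i from the right.
starWeight : ∀ {m} → Subset m → Subset m → ℕ
starWeight D S = sum (List.map (λ i → ∣ D ∩ atLeast i ∣) (elements S))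

∩-atLeast-zero : ∀ {m} (D : Subset (suc m)) → D ∩ atLeast zero ≡ D
∩-atLeast-zero D = trans (cong (D ∩_) (all-true _)) (∩-identityʳ D)
  where
  all-true : ∀ m → Vec.tabulate {n = m} (λ _ → true) ≡ ⊤
  all-true zero    = refl
  all-true (suc m) = cong (true ∷_) (all-true m)

∣∩-atLeast-suc∣ : ∀ {m} b (D : Subset m) i → ∣ (b ∷ D) ∩ atLeast (suc i) ∣ ≡ ∣ D ∩ atLeast i ∣
∣∩-atLeast-suc∣ b D i = trans
  -- The head of `atLeast (suc i)` is false, which absorbs b.
  (cong (λ c → ∣ c ∷ D ∩ Vec.tabulate (λ j → toℕ i <ᵇ suc (toℕ j)) ∣) (∧-zeroʳ b))
  (cong (λ T → ∣ D ∩ T ∣) (tabulate-cong λ j → <ᵇ-suc (toℕ i) (toℕ j)))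
  where
  <ᵇ-suc : ∀ x y → (x <ᵇ suc y) ≡ (x ≤ᵇ y)
  <ᵇ-suc zero    y = refl
  <ᵇ-suc (suc x) y = refl

-- A starred first position has all of `b ∷ D` at or to its right, so it weighs the full size; no
-- later position sees the first one.
starWeight-∷ : ∀ {m} b s (D S : Subset m) →
  starWeight (b ∷ D) (s ∷ S) ≡ (if s then ∣ b ∷ D ∣ else 0) ℕ.+ starWeight D S
starWeight-∷ b s D S = trans (cong (λ xs → sum (List.map w xs)) (elements-∷ s S)) (cases s)
  where
  w : Fin _ → ℕ
  w i = ∣ (b ∷ D) ∩ atLeast i ∣

  tail : sum (List.map w (List.map suc (elements S))) ≡ starWeight D S
  tail = cong sum (trans (sym (List.map-∘ (elements S)))
    (List.map-cong (∣∩-atLeast-suc∣ b D) (elements S)))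

  cases : ∀ s → sum (List.map w ((if s then zero ∷_ else id) (List.map suc (elements S))))
    ≡ (if s then ∣ b ∷ D ∣ else 0) ℕ.+ starWeight D S
  cases true  = cong₂ ℕ._+_ (cong ∣_∣ (∩-atLeast-zero (b ∷ D))) tail
  cases false = tail

-- The number of m-subsets of D of weight y. The target y is an integer because the recursion
-- subtracts from it and may pass below zero.
starCount : ∀ {M} (D : Subset M) m y → ℤ
starCount {M} D m y = total (subsets M) λ S →
  guard (does (S ⊆? D) ∧ does (∣ S ∣ ℕ.≟ m)) (guard (does (+ starWeight D S ℤ.≟ y)) 1ℤ)

-- Sets containing the first position are not contained in `false ∷ D`; the others keep their
-- weight.
starCount-outside : ∀ {M} (D : Subset M) m y → starCount (false ∷ D) m y ≡ starCount D m y
starCount-outside {M} D m y = trans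
  (total-cartesianProductWith _∷_ (true ∷ false ∷ []) (subsets M) _)
  (trans (cong₂ ℤ._+_ (total-zero (subsets M))
    (trans (ℤ.+-identityʳ _) (total-cong (subsets M) λ S →
      cong (λ w → guard (does (S ⊆? D) ∧ does (∣ S ∣ ℕ.≟ m)) (guard (does (+ w ℤ.≟ y)) 1ℤ))
        (starWeight-∷ false false D S))))
    (ℤ.+-identityˡ _))

starCount-inside-zero : ∀ {M} (D : Subset M) y → starCount (true ∷ D) 0 y ≡ starCount D 0 y
starCount-inside-zero {M} D y = trans
  (total-cartesianProductWith _∷_ (true ∷ false ∷ []) (subsets M) _)
  (trans (cong₂ ℤ._+_
    (trans (total-cong (subsets M) λ S →
      cong (λ b → guard b (guard (does (+ starWeight (true ∷ D) (true ∷ S) ℤ.≟ y)) 1ℤ))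
        (∧-zeroʳ (does (S ⊆? D))))
      (total-zero (subsets M)))
    (trans (ℤ.+-identityʳ _) (total-cong (subsets M) λ S →
      cong (λ w → guard (does (S ⊆? D) ∧ does (∣ S ∣ ℕ.≟ 0)) (guard (does (+ w ℤ.≟ y)) 1ℤ))
        (starWeight-∷ true false D S))))
    (ℤ.+-identityˡ _))

-- Split by whether the first descent, of rank |D| + 1, is starred: if so, it uses one star and
-- leaves weight y - (|D| + 1) for the rest.
starCount-inside-suc : ∀ {M} (D : Subset M) m y → starCount (true ∷ D) (suc m) y
  ≡ starCount D m (y - + suc ∣ D ∣) ℤ.+ starCount D (suc m) y
starCount-inside-suc {M} D m y = trans
  (total-cartesianProductWith _∷_ (true ∷ false ∷ []) (subsets M) _)
  (cong₂ ℤ._+_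
    (total-cong (subsets M) λ S →
      cong (λ b → guard (does (S ⊆? D) ∧ does (∣ S ∣ ℕ.≟ m)) (guard b 1ℤ))
        (trans (cong (λ w → does (+ w ℤ.≟ y)) (starWeight-∷ true true D S))
          (+-≟-move (+ suc ∣ D ∣) (+ starWeight D S) y)))
    (trans (ℤ.+-identityʳ _) (total-cong (subsets M) λ S →
      cong (λ w → guard (does (S ⊆? D) ∧ does (∣ S ∣ ℕ.≟ suc m)) (guard (does (+ w ℤ.≟ y)) 1ℤ))
        (starWeight-∷ true false D S))))

-- The weight of S is the sum of the ranks of its elements in D, counted from the
-- right, so in a step D ↦ true ∷ D a starred first position weighs 1 + |D| and the
-- recursion becomes the q-Pascal rule.
starCount-gauss : ∀ {M} (D : Subset M) m y →
  starCount D m y ≡ extend (gauss ∣ D ∣ m) (+ (m * ∣ D ∣) - + (m C 2) - y)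
-- The empty set has weight 0; both sides compute only once the sign of y is known.
starCount-gauss []          zero    (+ zero)  = refl
starCount-gauss []          zero    (+ suc n) = refl
starCount-gauss []          zero    -[1+ n ]  = refl
starCount-gauss []          (suc m) y         = sym (extend-zero (+ (m * 0) - + (suc m C 2) - y))
starCount-gauss (false ∷ D) m       y         = trans (starCount-outside D m y) (starCount-gauss D m y)
starCount-gauss (true ∷ D)  zero    y         = trans (starCount-inside-zero D y) (starCount-gauss D zero y)
starCount-gauss (true ∷ D)  (suc m) y         = begin
  starCount (true ∷ D) (suc m) y
    ≡⟨ starCount-inside-suc D m y ⟩
  starCount D m (y - + suc j) ℤ.+ starCount D (suc m) y
    ≡⟨ cong₂ ℤ._+_ (starCount-gauss D m (y - + suc j)) (starCount-gauss D (suc m) y) ⟩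
  extend (gauss j m) (+ (m * j) - + (m C 2) - (y - + suc j))
    ℤ.+ extend (gauss j (suc m)) (+ (suc m * j) - + (suc m C 2) - y)
    ≡⟨ cong₂ (λ u v → extend (gauss j m) u ℤ.+ extend (gauss j (suc m)) v) first second ⟩
  extend (gauss j m) z ℤ.+ extend (gauss j (suc m)) (z - + suc m)
    ≡⟨ cong (λ t → extend (gauss j m) z ℤ.+ t) (extend-shift (suc m) (gauss j (suc m)) z) ⟨
  extend (gauss j m) z ℤ.+ extend (shift (suc m) (gauss j (suc m))) z
    ≡⟨ extend-⊞ (gauss j m) (shift (suc m) (gauss j (suc m))) z ⟨
  extend (gauss (suc j) (suc m)) z ∎
  where
  open ≡-Reasoning
  j : ℕ
  j = ∣ D ∣
  -- The shortfall of y from (m + 1)(j + 1) - C(m + 1, 2) = (j + 1) + j + ... + (j + 1 - m), the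
  -- largest weight when m ≤ j.
  z : ℤ
  z = + (suc m * suc j) - + (suc m C 2) - y

  pascal : + (suc m C 2) ≡ + m ℤ.+ + (m C 2)
  pascal = cong +_ (trans (sym (nCk+nC[k+1]≡[n+1]C[k+1] m 1)) (cong (ℕ._+ m C 2) (nC1≡n m)))

  product : ∀ a b → + (suc a * b) ≡ + b ℤ.+ + a ℤ.* + b
  product a b = cong (λ t → + b ℤ.+ t) (ℤ.pos-* a b)

  -- Starring the first position uses the top rank, so the shortfall stays the same.
  first : + (m * j) - + (m C 2) - (y - + suc j) ≡ z
  first = trans (cong (λ t → t - + (m C 2) - (y - + suc j)) (ℤ.pos-* m j))
    (trans (ring (+ m) (+ j) (+ (m C 2)) y)
      (sym (cong₂ (λ s t → s - t - y) (product m (suc j)) pascal)))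
    where
    ring : ∀ m j c y → m ℤ.* j - c - (y - (1ℤ ℤ.+ j))
      ≡ (1ℤ ℤ.+ j) ℤ.+ m ℤ.* (1ℤ ℤ.+ j) - (m ℤ.+ c) - y
    ring = solve-∀

  -- Without it, each of the m + 1 top ranks is lower by one, which reduces the shortfall by m + 1.
  second : + (suc m * j) - + (suc m C 2) - y ≡ z - + suc m
  second = trans (cong (λ t → t - + (suc m C 2) - y) (product m j))
    (trans (ring (+ m) (+ j) (+ (suc m C 2)) y)
      (cong (λ t → t - + (suc m C 2) - y - + suc m) (sym (product m (suc j)))))
    where
    ring : ∀ m j c y → j ℤ.+ m ℤ.* j - c - y
      ≡ (1ℤ ℤ.+ j) ℤ.+ m ℤ.* (1ℤ ℤ.+ j) - c - y - (1ℤ ℤ.+ m)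
    ring = solve-∀

-- Coefficients of the two sides

-- Solving maj σ - w = d for w: fixing the exponent d fixes the weight at maj σ - d.
coeff-maj> : ∀ {n} (σ : Vec (Fin n) n) S d →
  coeff (q^ (maj> (σ , S))) d ≡ guard (does (+ starWeight (Des σ) S ℤ.≟ + maj σ - d)) 1ℤ
coeff-maj> σ S d = trans (coeff-monomial (maj> (σ , S)) d)
  (cong (λ b → guard b 1ℤ) (does-⇔
    (mk⇔ (λ { refl → move (+ maj σ) w }) (λ eq → trans (cong (λ x → + maj σ - x) eq) (back (+ maj σ) d)))
    (+ maj σ - w ℤ.≟ d) (w ℤ.≟ + maj σ - d)))
  where
  w : ℤ
  w = + starWeight (Des σ) S
  move : ∀ x y → y ≡ x - (x - y)
  move = solve-∀
  back : ∀ x y → x - (x - y) ≡ y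
  back = solve-∀

module _ (n m : ℕ) (d : ℤ) where

  -- The coefficient of q^d in q^(maj σ + C(m,2) - m des σ) [des σ, m].
  contribution : Vec (Fin n) n → ℤ
  contribution σ = extend (gauss (des σ) m) (+ (m * des σ) - + (m C 2) - (+ maj σ - d))

  -- With m = n - k, this accounts for the permutations that no index of the right-hand sum reaches.
  contribution-vanish : ∀ σ → des σ < m → contribution σ ≡ 0ℤ
  contribution-vanish σ des<m = trans (extend-cong (gauss-< des<m) x) (extend-zero x)
    where
    x : ℤ
    x = + (m * des σ) - + (m C 2) - (+ maj σ - d)

  -- Grouping starred permutations by σ leaves, for each σ, the count of its star sets of weight maj
  -- σ - d.
  coeff-starred : coeff (∑[ x ← 𝔖> n m ] q^ (maj> x)) d ≡ total (𝔖 n) contribution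
  coeff-starred = begin
    coeff (∑[ x ← 𝔖> n m ] q^ (maj> x)) d
      ≡⟨ coeff-∑ (𝔖> n m) _ d ⟩
    total (𝔖> n m) (λ x → coeff (q^ (maj> x)) d)
      ≡⟨ total-filter (isStarred? m) (List.cartesianProduct (𝔖 n) (subsets (pred n))) _ ⟩
    total (List.cartesianProduct (𝔖 n) (subsets (pred n)))
      (λ x → guard (does (isStarred? m x)) (coeff (q^ (maj> x)) d))
      ≡⟨ total-cartesianProductWith _,_ (𝔖 n) (subsets (pred n)) _ ⟩
    total (𝔖 n) (λ σ → total (subsets (pred n))
      (λ S → guard (does (isStarred? m (σ , S))) (coeff (q^ (maj> (σ , S))) d)))
      ≡⟨ total-cong (𝔖 n) (λ σ → total-cong (subsets (pred n)) λ S →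
           cong (guard (does (isStarred? m (σ , S)))) (coeff-maj> σ S d)) ⟩
    total (𝔖 n) (λ σ → starCount (Des σ) m (+ maj σ - d))
      ≡⟨ total-cong (𝔖 n) (λ σ → starCount-gauss (Des σ) m (+ maj σ - d)) ⟩
    total (𝔖 n) contribution ∎
    where open ≡-Reasoning

  -- The prefactor is the same for all permutations with j descents, so it moves inside the sum over
  -- σ; m ≤ j lets `qBinomial` be replaced by `gauss`.
  coeff-summand : ∀ j → m ≤ j →
    coeff (q^ (+ (m C 2) - + (m * j)) · ⟦ qBinomial j m ⟧ · A n j) d
      ≡ total (𝔖 n) (λ σ → guard (does (des σ ℕ.≟ j)) (contribution σ))
  coeff-summand j m≤j = begin
    coeff (q^ a · ⟦ qBinomial j m ⟧ · A n j) d
      ≡⟨ coeff-·∑q^ (q^ a · ⟦ qBinomial j m ⟧) (List.filter (λ σ → des σ ℕ.≟ j) (𝔖 n)) _ d ⟩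
    total (List.filter (λ σ → des σ ℕ.≟ j) (𝔖 n))
      (λ σ → coeff (q^ a · ⟦ qBinomial j m ⟧) (d - + maj σ))
      ≡⟨ total-filter (λ σ → des σ ℕ.≟ j) (𝔖 n) _ ⟩
    total (𝔖 n) (λ σ → guard (does (des σ ℕ.≟ j))
      (coeff (q^ a · ⟦ qBinomial j m ⟧) (d - + maj σ)))
      ≡⟨ total-cong (𝔖 n) (λ σ → guard-cong (des σ ℕ.≟ j) (term σ)) ⟩
    total (𝔖 n) (λ σ → guard (does (des σ ℕ.≟ j)) (contribution σ)) ∎
    where
    open ≡-Reasoning
    a : ℤ
    a = + (m C 2) - + (m * j)

    ring : ∀ d s c p → d - s - (c - p) ≡ p - c - (s - d)
    ring = solve-∀

    term : ∀ σ → des σ ≡ j →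
      coeff (q^ a · ⟦ qBinomial j m ⟧) (d - + maj σ) ≡ contribution σ
    term σ refl = begin
      coeff (q^ a · ⟦ qBinomial j m ⟧) (d - + maj σ)
        ≡⟨ coeff-q^· a ⟦ qBinomial j m ⟧ (d - + maj σ) ⟩
      coeff ⟦ qBinomial j m ⟧ (d - + maj σ - a)
        ≡⟨ coeff-termsFrom 0 (qBinomial j m) (d - + maj σ - a) ⟩
      extend (at (qBinomial j m)) (d - + maj σ - a)
        ≡⟨ extend-cong (qBinomial-gauss m≤j) (d - + maj σ - a) ⟩
      extend (gauss j m) (d - + maj σ - a)
        ≡⟨ cong (extend (gauss j m)) (ring d (+ maj σ) (+ (m C 2)) (+ (m * j))) ⟩
      contribution σ ∎

proposition5p1p1 : (n k : ℕ) → 1 ≤ n → 1 ≤ k → k ≤ n →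
    (∑[ x ← 𝔖> n (n ∸ k) ] q^ (maj> x))
      ≈ (∑[ i ← range k ]
          q^ (+ ((n ∸ k) C 2) - + ((n ∸ k) * (n ∸ i)))
            · ⟦ qBinomial (n ∸ i) (n ∸ k) ⟧
            · A n (n ∸ i))
proposition5p1p1 n@(suc n-1) k 1≤n 1≤k k≤n d = begin
  coeff (∑[ x ← 𝔖> n m ] q^ (maj> x)) d
    ≡⟨ coeff-starred n m d ⟩
  total (𝔖 n) h
    -- `Des σ` is a subset of n - 1 positions, so des σ < n: either a unique i in the range has des
    -- σ = n - i, or des σ < n - k and the contribution is zero.
    ≡⟨ total-cong (𝔖 n) (λ σ → range-hit (h σ) k≤n (s≤s (∣p∣≤n (Des σ)))
         (contribution-vanish n m d σ)) ⟨
  total (𝔖 n) (λ σ → total (range k) (λ i → guard (does (des σ ℕ.≟ n ∸ i)) (h σ)))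
    ≡⟨ total-swap (𝔖 n) (range k) _ ⟩
  total (range k) (λ i → total (𝔖 n) (λ σ → guard (does (des σ ℕ.≟ n ∸ i)) (h σ)))
    -- The entries of the range are `suc i` with i < k, hence n - (i + 1) ≥ n - k, as
    -- `coeff-summand` requires.
    ≡⟨ total-cong-All (applyUpTo⁺₁ suc k
         (λ {i} i<k → coeff-summand n m d (n ∸ suc i) (ℕ.∸-monoʳ-≤ n i<k))) ⟨
  total (range k) (λ i → coeff (summand i) d)
    ≡⟨ coeff-∑ (range k) summand d ⟨
  coeff (∑ (range k) summand) d ∎
  where
  open ≡-Reasoning
  m : ℕ
  m = n ∸ k
  h : Vec (Fin n) n → ℤ
  h = contribution n m d
  summand : ℕ → Laurent
  summand i = q^ (+ (m C 2) - + (m * (n ∸ i))) · ⟦ qBinomial (n ∸ i) m ⟧ · A n (n ∸ i)
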